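{- Let $K\subset L$ be a field extension. Let $A$ and $B$ be two $n$-dimensional $K$-subspaces of $L$ with $1\notin B$ and $n>1$. Assume further that one of the following conditions holds: (1) $B\cap M=\{0\}$ for every finite-dimensional intermediate field $K\subset M\subsetneq L$, and either $n\leq 5$ or every algebraic element of $L$ is separable over $K$; (2) $n=p(K,L)$ and $A$ is not a linear translate of any nontrivial intermediate field $K\subset M\subsetneq L$; (3) $A$ is a Sidon subspace. Then $A$ is matched to $B$.
   Context: For $n$-dimensional $K$-subspaces $A,B$ of $L$, an ordered basis $\{a_1,\ldots,a_n\}$ of $A$ is matched to an ordered basis $\{b_1,\ldots,b_n\}$ of $B$ if $a_i^{ -1}A\cap B\subset\langle b_1,\ldots,b_{i-1},b_{i+1},\ldots,b_n\rangle$ for each $1\le i\le n$ (angle brackets denote $K$-span). $A$ is matched to $B$ if every ordered basis of $A$ can be matched to some ordered basis of $B$. $p(K,L)$ denotes the smallest degree $[M:K]$ of an intermediate field $K\subsetneq M\subset L$ ($p(K,L)=\infty$ if there is none of finite degree, e.g. purely transcendental). A linear translate of an intermediate field $M$ is a $K$-subspace of the form $lM$ with $l\in L^*$. A $K$-subspace $A$ of $L$ is a Sidon subspace if $\dim_K(A\cap xA)\le 1$ for all $x\in L\setminus K$. -}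

module Defs where

open import Level using (Level; _⊔_) renaming (suc to lsuc)
open import Algebra.Bundles using (CommutativeRing)
open import Algebra.Core using (Op₁)
open import Data.Fin.Base using (Fin)
open import Data.List.Base as List using (List; []; _∷_; _∷ʳ_; length)
open import Data.List.Relation.Unary.All using (All)
open import Data.List.Relation.Unary.Any using (Any)
open import Data.Nat.Base using (ℕ; zero; suc; _≤_)
open import Data.Product.Base using (_×_; ∃; ∃₂)
open import Data.Vec.Functional using (Vector)
open import Relation.Binary.PropositionalEquality.Core using (_≢_)
open import Relation.Nullary.Negation.Core using (¬_)
open import Relation.Unary using (Pred; _∈_; _∉_; _⊆_; _⊂_; _≐_; _∩_)

import Algebra.Definitions.RawMonoid as RawMonoidDefs

-- The inverse is a total operation, whose value at zero is unconstrained.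
record Field c ℓ : Set (lsuc (c ⊔ ℓ)) where
  infix 9 _⁻¹
  field
    commutativeRing : CommutativeRing c ℓ

  open CommutativeRing commutativeRing public

  field
    _⁻¹     : Op₁ Carrier
    ⁻¹-cong : ∀ {x y} → x ≈ y → x ⁻¹ ≈ y ⁻¹
    *-inv   : ∀ x → ¬ (x ≈ 0#) → x * x ⁻¹ ≈ 1#
    1≉0     : ¬ (1# ≈ 0#)

module FieldTheory {c ℓ : Level} (L : Field c ℓ) where

  open Field L
  open RawMonoidDefs +-rawMonoid using (sum) renaming (_×_ to _·_)

  -- Subfields, intermediate fields and subspaces are all subsets of L.
  -- Since L is a setoid, they are required to respect its equality.
  Subset : Set (lsuc (c ⊔ ℓ))
  Subset = Pred Carrier (c ⊔ ℓ)

  infixr 8 _•_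

  _•_ : Carrier → Subset → Subset
  (x • A) y = ∃ λ a → a ∈ A × y ≈ x * a

  record IsSubfield (K : Subset) : Set (c ⊔ ℓ) where
    field
      resp       : ∀ {x y} → x ≈ y → x ∈ K → y ∈ K
      0-closed   : 0# ∈ K
      1-closed   : 1# ∈ K
      +-closed   : ∀ {x y} → x ∈ K → y ∈ K → x + y ∈ K
      neg-closed : ∀ {x} → x ∈ K → - x ∈ K
      *-closed   : ∀ {x y} → x ∈ K → y ∈ K → x * y ∈ K
      ⁻¹-closed  : ∀ {x} → ¬ (x ≈ 0#) → x ∈ K → x ⁻¹ ∈ K

  module Over (K : Subset) where

    IsIntermediateField : Subset → Set (c ⊔ ℓ)
    IsIntermediateField M = IsSubfield M × K ⊆ M

    record IsSubspace (A : Subset) : Set (c ⊔ ℓ) where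
      field
        resp     : ∀ {x y} → x ≈ y → x ∈ A → y ∈ A
        0-closed : 0# ∈ A
        +-closed : ∀ {x y} → x ∈ A → y ∈ A → x + y ∈ A
        ·-closed : ∀ {k x} → k ∈ K → x ∈ A → k * x ∈ A

    Span : ∀ {s} → Pred Carrier s → Pred Carrier (c ⊔ ℓ ⊔ s)
    Span S x = ∃ λ (m : ℕ) → ∃₂ λ (k v : Vector Carrier m) →
      (∀ i → k i ∈ K) × (∀ i → v i ∈ S) × x ≈ sum (λ i → k i * v i)

    LinearlyIndependent : ∀ {n} → Vector Carrier n → Set (c ⊔ ℓ)
    LinearlyIndependent {n} v = (k : Vector Carrier n) → (∀ i → k i ∈ K) →
      sum (λ i → k i * v i) ≈ 0# → ∀ i → k i ≈ 0#

    Range : ∀ {n} → Vector Carrier n → Pred Carrier ℓ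
    Range v x = ∃ λ i → x ≈ v i

    IsBasis : ∀ {n} → Vector Carrier n → Subset → Set (c ⊔ ℓ)
    IsBasis v A = LinearlyIndependent v × Span (Range v) ≐ A

    HasDim : Subset → ℕ → Set (c ⊔ ℓ)
    HasDim A n = ∃ λ (v : Vector Carrier n) → IsBasis v A

    FiniteDimensional : Subset → Set (c ⊔ ℓ)
    FiniteDimensional A = ∃ λ n → HasDim A n

    Dim≤ : Subset → ℕ → Set (c ⊔ ℓ)
    Dim≤ A n = ∃ λ d → d ≤ n × HasDim A d

    RangeExcept : ∀ {n} → Vector Carrier n → Fin n → Pred Carrier ℓ
    RangeExcept v i x = ∃ λ j → j ≢ i × x ≈ v j

    BasisMatched : ∀ {n} → Subset → Subset →
      Vector Carrier n → Vector Carrier n → Set (c ⊔ ℓ)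
    BasisMatched A B a b =
      ∀ i → (a i ⁻¹ • A) ∩ B ⊆ Span (RangeExcept b i)

    Matched : ℕ → Subset → Subset → Set (c ⊔ ℓ)
    Matched n A B = (a : Vector Carrier n) → IsBasis a A →
      ∃ λ (b : Vector Carrier n) → IsBasis b B × BasisMatched A B a b

    -- n = p(K,L); this holds for no n when p(K,L) = ∞.
    IsSmallestDegree : ℕ → Set (lsuc (c ⊔ ℓ))
    IsSmallestDegree n =
      (∃ λ M → IsIntermediateField M × K ⊂ M × HasDim M n) ×
      (∀ M d → IsIntermediateField M → K ⊂ M → HasDim M d → n ≤ d)

    IsLinearTranslate : Subset → Subset → Set (c ⊔ ℓ)
    IsLinearTranslate A M = ∃ λ l → ¬ (l ≈ 0#) × A ≐ l • M

    IsSidon : Subset → Set (c ⊔ ℓ)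
    IsSidon A = ∀ x → x ∉ K → Dim≤ (A ∩ x • A) 1

    -- Polynomials are coefficient lists, constant term first; trailing zeros
    -- are allowed, so equality is coefficientwise rather than listwise.
    Poly : Set c
    Poly = List Carrier

    coeff : Poly → ℕ → Carrier
    coeff []      _       = 0#
    coeff (a ∷ p) zero    = a
    coeff (a ∷ p) (suc i) = coeff p i

    infix 4 _≈ₚ_

    _≈ₚ_ : Poly → Poly → Set ℓ
    p ≈ₚ q = ∀ i → coeff p i ≈ coeff q i

    infixl 6 _+ₚ_
    infixl 7 _*ₚ_

    _+ₚ_ : Poly → Poly → Poly
    []      +ₚ q       = q
    (a ∷ p) +ₚ []      = a ∷ p
    (a ∷ p) +ₚ (b ∷ q) = a + b ∷ p +ₚ q

    _*ₚ_ : Poly → Poly → Poly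
    []      *ₚ q = []
    (a ∷ p) *ₚ q = List.map (a *_) q +ₚ (0# ∷ p *ₚ q)

    eval : Poly → Carrier → Carrier
    eval []      x = 0#
    eval (a ∷ p) x = a + x * eval p x

    -- derivFrom k p is the list of (k + i) · pᵢ.
    derivFrom : ℕ → Poly → Poly
    derivFrom k []      = []
    derivFrom k (a ∷ p) = k · a ∷ derivFrom (suc k) p

    deriv : Poly → Poly
    deriv []      = []
    deriv (a ∷ p) = derivFrom 1 p

    OverK : Poly → Set (c ⊔ ℓ)
    OverK = All (_∈ K)

    -- A list cs stands for the monic polynomial of degree length cs whose
    -- lower coefficients are cs.
    monic : List Carrier → Poly
    monic cs = cs ∷ʳ 1#

    IsMinimalPolynomial : Carrier → List Carrier → Set (c ⊔ ℓ)
    IsMinimalPolynomial x cs =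
      OverK cs × eval (monic cs) x ≈ 0# ×
      (∀ ds → OverK ds → eval (monic ds) x ≈ 0# → length cs ≤ length ds)

    -- Bézout form of coprimality in K[X].
    CoprimePoly : Poly → Poly → Set (c ⊔ ℓ)
    CoprimePoly p q = ∃₂ λ u v →
      OverK u × OverK v × u *ₚ p +ₚ v *ₚ q ≈ₚ 1# ∷ []

    SeparablePoly : Poly → Set (c ⊔ ℓ)
    SeparablePoly p = CoprimePoly p (deriv p)

    IsAlgebraic : Carrier → Set (c ⊔ ℓ)
    IsAlgebraic x = ∃ λ p →
      OverK p × Any (λ a → ¬ (a ≈ 0#)) p × eval p x ≈ 0#

    IsSeparable : Carrier → Set (c ⊔ ℓ)
    IsSeparable x = ∃ λ cs →
      IsMinimalPolynomial x cs × SeparablePoly (monic cs)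

module Submission where

open import Defs
open import Axiom.ExcludedMiddle using (ExcludedMiddle)
open import Data.Fin.Base using (Fin; zero; suc; punchIn; punchOut)
open import Data.Fin.Properties using (_≟_; punchInᵢ≢i; punchIn-punchOut)
open import Data.Fin.Subset as Fin using (∣_∣; ⁅_⁆; inside; outside)
open import Data.Nat.Base as ℕ using (ℕ; zero; suc; _≤_; _<_; z≤n; s≤s)
open import Data.Nat.Induction using (<-wellFounded)
open import Data.Product.Base using (_×_; ∃; ∃₂; _,_; proj₁; proj₂)
open import Data.Sum.Base using (_⊎_; inj₁; inj₂; [_,_]′; map₁)
open import Data.Vec.Base using ([]; _∷_; here; there)
open import Data.Vec.Functional as Vector using (Vector; head; tail; updateAt)
open import Data.Vec.Functional.Properties using (updateAt-updates; updateAt-minimal)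
open import Function.Base using (_∘_)
open import Induction.WellFounded using (Acc; acc)
open import Level using (_⊔_) renaming (suc to lsuc)
open import Relation.Binary.PropositionalEquality as ≡ using (_≡_; _≢_)
open import Relation.Nullary using (¬_; yes; no; contradiction)
open import Relation.Nullary.Decidable using (decidable-stable)
open import Relation.Unary using (Pred; _∈_; _∉_; _⊆_; _⊂_; _≐_; _∩_; U)

import Algebra.Properties.CommutativeSemigroup as CommutativeSemigroupProperties
import Algebra.Properties.Ring as RingProperties
import Algebra.Properties.Semiring.Sum as SemiringSum
import Data.Fin.Subset.Properties as Fin
import Data.Nat.Properties as ℕ

-- Let a be a basis of A and Vᵢ = aᵢ⁻¹A ∩ B.  A basis b of B with Vᵢ ⊆ ⟨bⱼ : j ≠ i⟩ exists
-- as soon as dim ⋂_{j∈J} Vⱼ + |J| ≤ n for all J (Rado's theorem, in dual form): enlarge the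
-- Vᵢ to hyperplanes Hᵢ without violating the inequalities, and take bᵢ ≠ 0 in ⋂_{j≠i} Hⱼ.
-- For the inequality, put S = ⟨aⱼ : j ∈ J⟩ and T = K + ⋂_{j∈J} Vⱼ, so that 1 ∈ T and ST ⊆ A;
-- one needs dim S + dim T ≤ n + 1.  Linear Dyson e-transforms keep dim S + dim T and
-- ST ⊆ A, and never enlarge T; they end with ST ⊆ S.  Then T lies in the field
-- M = {x : xS ⊆ S}, of finite degree at most dim S, and each of the conditions (1)–(3)
-- forces M ∩ T ⊆ K.  Hence dim T ≤ 1, while dim S ≤ n.

-- Cardinalities of finite index sets

open CommutativeSemigroupProperties ℕ.+-commutativeSemigroup
  using () renaming (interchange to ℕ-interchange)

∣p∪q∣+∣p∩q∣ : ∀ {n} (p q : Fin.Subset n) →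
  ∣ p Fin.∪ q ∣ ℕ.+ ∣ p Fin.∩ q ∣ ≡ ∣ p ∣ ℕ.+ ∣ q ∣
∣p∪q∣+∣p∩q∣ []            []            = ≡.refl
∣p∪q∣+∣p∩q∣ (outside ∷ p) (outside ∷ q) = ∣p∪q∣+∣p∩q∣ p q
∣p∪q∣+∣p∩q∣ (inside  ∷ p) (outside ∷ q) = ≡.cong suc (∣p∪q∣+∣p∩q∣ p q)
∣p∪q∣+∣p∩q∣ (outside ∷ p) (inside  ∷ q) =
  ≡.trans (≡.cong suc (∣p∪q∣+∣p∩q∣ p q)) (≡.sym (ℕ.+-suc ∣ p ∣ ∣ q ∣))
∣p∪q∣+∣p∩q∣ (inside  ∷ p) (inside  ∷ q) = ≡.cong suc
  (≡.trans (ℕ.+-suc ∣ p Fin.∪ q ∣ ∣ p Fin.∩ q ∣)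
    (≡.trans (≡.cong suc (∣p∪q∣+∣p∩q∣ p q)) (≡.sym (ℕ.+-suc ∣ p ∣ ∣ q ∣))))

∣p∣≤1+∣p-x∣ : ∀ {n} (p : Fin.Subset n) x → ∣ p ∣ ≤ suc ∣ p Fin.- x ∣
∣p∣≤1+∣p-x∣ p x = begin
  ∣ p ∣                           ≤⟨ Fin.p⊆q⇒∣p∣≤∣q∣ p⊆ ⟩
  ∣ ⁅ x ⁆ Fin.∪ (p Fin.- x) ∣       ≤⟨ ℕ.m≤m+n _ _ ⟩
  ∣ ⁅ x ⁆ Fin.∪ (p Fin.- x) ∣ ℕ.+ _ ≡⟨ ∣p∪q∣+∣p∩q∣ ⁅ x ⁆ (p Fin.- x) ⟩
  ∣ ⁅ x ⁆ ∣ ℕ.+ ∣ p Fin.- x ∣     ≡⟨ ≡.cong (ℕ._+ ∣ p Fin.- x ∣) (Fin.∣⁅x⁆∣≡1 x) ⟩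
  suc ∣ p Fin.- x ∣               ∎
  where
  open ℕ.≤-Reasoning
  p⊆ : p Fin.⊆ ⁅ x ⁆ Fin.∪ (p Fin.- x)
  p⊆ {y} y∈p with y ≟ x
  ... | yes ≡.refl = Fin.x∈p∪q⁺ (inj₁ (Fin.x∈⁅x⁆ x))
  ... | no  y≢x    = Fin.x∈p∪q⁺ (inj₂ (Fin.x∈p∧x≢y⇒x∈p-y y∈p y≢x))

x∉p-x : ∀ {n} (p : Fin.Subset n) x → x Fin.∉ p Fin.- x
x∉p-x (_ ∷ p) (suc x) (there x∈) = x∉p-x p x x∈

-- Two violations add up to at least 2n + 2, whereas the bounds for union and intersection allow at
-- most 2n + 1; the extra one pays for the index removed from the intersection (`c ≤ suc b`).
submodular-bound : ∀ {n d₁ d₂ j₁ j₂ p q a b c} →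
  p ℕ.+ q ≡ d₁ ℕ.+ d₂ → a ℕ.+ c ≡ j₁ ℕ.+ j₂ → c ≤ suc b →
  p ℕ.+ a ≤ n → q ℕ.+ b ≤ n → n < d₁ ℕ.+ j₁ → ¬ n < d₂ ℕ.+ j₂
submodular-bound {n} {d₁} {d₂} {j₁} {j₂} {p} {q} {a} {b} {c} p+q a+c c≤b pa≤n qb≤n dj₁ dj₂ =
  ℕ.1+n≰n (begin
    suc (suc (n ℕ.+ n))                 ≡⟨ ≡.cong suc (ℕ.+-suc n n) ⟨
    suc n ℕ.+ suc n                     ≤⟨ ℕ.+-mono-≤ dj₁ dj₂ ⟩
    (d₁ ℕ.+ j₁) ℕ.+ (d₂ ℕ.+ j₂)         ≡⟨ ℕ-interchange d₁ j₁ d₂ j₂ ⟩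
    (d₁ ℕ.+ d₂) ℕ.+ (j₁ ℕ.+ j₂)         ≡⟨ ≡.cong₂ ℕ._+_ p+q a+c ⟨
    (p ℕ.+ q) ℕ.+ (a ℕ.+ c)             ≤⟨ ℕ.+-monoʳ-≤ (p ℕ.+ q) (ℕ.+-monoʳ-≤ a c≤b) ⟩
    (p ℕ.+ q) ℕ.+ (a ℕ.+ suc b)         ≡⟨ ℕ-interchange p q a (suc b) ⟩
    (p ℕ.+ a) ℕ.+ (q ℕ.+ suc b)         ≡⟨ ≡.cong (p ℕ.+ a ℕ.+_) (ℕ.+-suc q b) ⟩
    (p ℕ.+ a) ℕ.+ suc (q ℕ.+ b)         ≤⟨ ℕ.+-mono-≤ pa≤n (s≤s qb≤n) ⟩
    n ℕ.+ suc n                         ≡⟨ ℕ.+-suc n n ⟩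
    suc (n ℕ.+ n)                       ∎)
  where open ℕ.≤-Reasoning

module LinearMatching
  (em : ∀ {a} → ExcludedMiddle a) {c ℓ} (L : Field c ℓ)
  (K : FieldTheory.Subset L) (K-isSubfield : FieldTheory.IsSubfield L K)
  where

  open Field L hiding (zero)
  open FieldTheory L
  open Over K
  open RingProperties ring using (-1*x≈-x)
  open CommutativeSemigroupProperties *-commutativeSemigroup
    using () renaming (x∙yz≈y∙xz to x*yz≈y*xz; xy∙z≈y∙xz to xy*z≈y*xz)
  open CommutativeSemigroupProperties +-commutativeSemigroup
    using () renaming (interchange to +-interchange)
  open SemiringSum semiring
    using (sum; sum-cong-≋; sum-replicate-zero; sum-remove; ∑-distrib-+; *-distribˡ-sum)

  -- Inverses in L and the lattice of K-subspaces

  module 𝕂 = IsSubfield K-isSubfield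

  ⊆-or-∉ : ∀ {a b} (P : Pred Carrier a) (Q : Pred Carrier b) →
    P ⊆ Q ⊎ ∃ λ x → x ∈ P × x ∉ Q
  ⊆-or-∉ P Q with em {P = ∃ λ x → x ∈ P × x ∉ Q}
  ... | yes p = inj₂ p
  ... | no ¬p = inj₁ λ {x} x∈P → decidable-stable em λ x∉Q → ¬p (x , x∈P , x∉Q)

  inverse-cancelʳ : ∀ {x} y → ¬ x ≈ 0# → x * (x ⁻¹ * y) ≈ y
  inverse-cancelʳ y x≉0 =
    trans (sym (*-assoc _ _ _)) (trans (*-congʳ (*-inv _ x≉0)) (*-identityˡ y))

  inverse-cancelˡ : ∀ {x} y → ¬ x ≈ 0# → x ⁻¹ * (x * y) ≈ y
  inverse-cancelˡ y x≉0 = trans (x*yz≈y*xz _ _ y) (inverse-cancelʳ y x≉0)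

  inverse-≉0 : ∀ {x} → ¬ x ≈ 0# → ¬ x ⁻¹ ≈ 0#
  inverse-≉0 x≉0 x⁻¹≈0 =
    1≉0 (trans (sym (*-inv _ x≉0)) (trans (*-congˡ x⁻¹≈0) (zeroʳ _)))

  -1∈K : - 1# ∈ K
  -1∈K = 𝕂.neg-closed 𝕂.1-closed

  record Subspace : Set (lsuc (c ⊔ ℓ)) where
    field
      set        : Subset
      isSubspace : IsSubspace set

    open IsSubspace isSubspace public

    neg∈ : ∀ {x} → x ∈ set → - x ∈ set
    neg∈ x∈ = resp (-1*x≈-x _) (·-closed -1∈K x∈)

    cancel∈ : ∀ {x y} → x + y ∈ set → y ∈ set → x ∈ set
    cancel∈ x+y∈ y∈ = resp
      (trans (+-assoc _ _ _) (trans (+-congˡ (-‿inverseʳ _)) (+-identityʳ _)))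
      (+-closed x+y∈ (neg∈ y∈))

    unscale∈ : ∀ {k x} → k ∈ K → ¬ k ≈ 0# → k * x ∈ set → x ∈ set
    unscale∈ k∈K k≉0 kx∈ =
      resp (inverse-cancelˡ _ k≉0) (·-closed (𝕂.⁻¹-closed k≉0 k∈K) kx∈)

  open Subspace

  infix 4 _⊑_
  infixl 6 _⊞_
  infixl 7 _⊓_
  infixl 8 _⟨_⟩

  _⊑_ : Subspace → Subspace → Set (c ⊔ ℓ)
  V ⊑ W = set V ⊆ set W

  _⊓_ : Subspace → Subspace → Subspace
  V ⊓ W = record
    { set = set V ∩ set W
    ; isSubspace = record
      { resp     = λ e (p , q) → resp V e p , resp W e q
      ; 0-closed = 0-closed V , 0-closed W
      ; +-closed = λ (p , q) (p′ , q′) → +-closed V p p′ , +-closed W q q′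
      ; ·-closed = λ k (p , q) → ·-closed V k p , ·-closed W k q
      }
    }

  _⊞_ : Subspace → Subspace → Subspace
  V ⊞ W = record
    { set = λ x → ∃₂ λ v w → v ∈ set V × w ∈ set W × x ≈ v + w
    ; isSubspace = record
      { resp     = λ e (v , w , p , q , e′) → v , w , p , q , trans (sym e) e′
      ; 0-closed = 0# , 0# , 0-closed V , 0-closed W , sym (+-identityˡ _)
      ; +-closed = λ (v , w , p , q , e) (v′ , w′ , p′ , q′ , e′) →
          v + v′ , w + w′ , +-closed V p p′ , +-closed W q q′ ,
          trans (+-cong e e′) (+-interchange v w v′ w′)
      ; ·-closed = λ k∈K (v , w , p , q , e) →
          _ , _ , ·-closed V k∈K p , ·-closed W k∈K q ,
          trans (*-congˡ e) (distribˡ _ v w)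
      }
    }

  line : Carrier → Subspace
  line x = record
    { set = λ y → ∃ λ k → k ∈ K × y ≈ k * x
    ; isSubspace = record
      { resp     = λ e (k , p , e′) → k , p , trans (sym e) e′
      ; 0-closed = 0# , 𝕂.0-closed , sym (zeroˡ x)
      ; +-closed = λ (k , p , e) (k′ , p′ , e′) →
          k + k′ , 𝕂.+-closed p p′ , trans (+-cong e e′) (sym (distribʳ x k k′))
      ; ·-closed = λ l∈K (k , p , e) →
          _ , 𝕂.*-closed l∈K p , trans (*-congˡ e) (sym (*-assoc _ k x))
      }
    }

  _⟨_⟩ : Subspace → Carrier → Subspace
  V ⟨ x ⟩ = V ⊞ line x

  -- For x ≠ 0 this is x⁻¹V, encoded without an existential so that membership carries no witness.
  -- The translate eT is accordingly `preimage (e ⁻¹) T`.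
  preimage : Carrier → Subspace → Subspace
  preimage x V = record
    { set = λ y → x * y ∈ set V
    ; isSubspace = record
      { resp     = λ e → resp V (*-congˡ e)
      ; 0-closed = resp V (sym (zeroʳ x)) (0-closed V)
      ; +-closed = λ p q → resp V (sym (distribˡ x _ _)) (+-closed V p q)
      ; ·-closed = λ k∈K p → resp V (x*yz≈y*xz _ _ _) (·-closed V k∈K p)
      }
    }

  ⊞-inˡ : ∀ V W → V ⊑ V ⊞ W
  ⊞-inˡ V W p = _ , 0# , p , 0-closed W , sym (+-identityʳ _)

  ⊞-inʳ : ∀ V W → W ⊑ V ⊞ W
  ⊞-inʳ V W p = 0# , _ , 0-closed V , p , sym (+-identityˡ _)

  ⊞-least : ∀ V W X → V ⊑ X → W ⊑ X → V ⊞ W ⊑ X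
  ⊞-least V W X V⊑X W⊑X (_ , _ , p , q , e) =
    resp X (sym e) (+-closed X (V⊑X p) (W⊑X q))

  x∈line : ∀ x → x ∈ set (line x)
  x∈line x = 1# , 𝕂.1-closed , sym (*-identityˡ x)

  line-least : ∀ {x} X → x ∈ set X → line x ⊑ X
  line-least X x∈X (_ , k∈K , e) = resp X (sym e) (·-closed X k∈K x∈X)

  ⟨⟩-in : ∀ V x → x ∈ set (V ⟨ x ⟩)
  ⟨⟩-in V x = ⊞-inʳ V (line x) (x∈line x)

  ⟨⟩-least : ∀ V {x} X → V ⊑ X → x ∈ set X → V ⟨ x ⟩ ⊑ X
  ⟨⟩-least V X V⊑X x∈X = ⊞-least V (line _) X V⊑X (line-least X x∈X)

  -- Dimension

  infix 4 _⋖_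
  -- The covering relation in the lattice of subspaces: W is V plus one line, and a generator of
  -- that line is kept as `top`.
  record _⋖_ (V W : Subspace) : Set (c ⊔ ℓ) where
    field
      top   : Carrier
      below : V ⊑ W
      top∈  : top ∈ set W
      top∉  : top ∉ set V
      cover : W ⊑ V ⟨ top ⟩

  ⋖-intro : ∀ V {x} → x ∉ set V → V ⋖ V ⟨ x ⟩
  ⋖-intro V {x} x∉V = record
    { top = x ; below = ⊞-inˡ V (line x) ; top∈ = ⟨⟩-in V x ; top∉ = x∉V ; cover = λ p → p }

  -- Steinitz exchange: in y = v + kx the scalar k is nonzero because y ∉ V, so the equation can be
  -- solved for x.
  ⟨⟩-exchange : ∀ V {x y} → y ∈ set (V ⟨ x ⟩) → y ∉ set V → x ∈ set (V ⟨ y ⟩)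
  ⟨⟩-exchange V {x} {y} (v , w , v∈V , (k , k∈K , w≈kx) , y≈v+w) y∉V =
    unscale∈ X k∈K k≉0 (cancel∈ X
      (resp X (trans y≈v+w (trans (+-congˡ w≈kx) (+-comm _ _))) (⟨⟩-in V y))
      (⊞-inˡ V (line y) v∈V))
    where
    X = V ⟨ y ⟩
    k≉0 : ¬ k ≈ 0#
    k≉0 k≈0 = y∉V (resp V (sym (trans y≈v+w (trans (+-congˡ
      (trans w≈kx (trans (*-congʳ k≈0) (zeroˡ x)))) (+-identityʳ v)))) v∈V)

  ⋖-exchange : ∀ {V W y} → V ⋖ W → y ∈ set W → y ∉ set V → W ⊑ V ⟨ y ⟩
  ⋖-exchange {V} {W} {y} V⋖W y∈W y∉V w∈W =
    ⟨⟩-least V (V ⟨ y ⟩) (⊞-inˡ V (line y)) (⟨⟩-exchange V (cover y∈W) y∉V) (cover w∈W)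
    where open _⋖_ V⋖W

  -- Modular law: H ∩ (V + Kh) = (H ∩ V) + Kh for h ∈ H.
  ⋖-⊓ : ∀ {V W h} H → V ⋖ W → H ⊑ W → h ∈ set H → h ∉ set V → H ⊓ V ⋖ H
  ⋖-⊓ {V} {W} {h} H V⋖W H⊑W h∈H h∉V = record
    { top = h ; below = proj₁ ; top∈ = h∈H ; top∉ = h∉V ∘ proj₂ ; cover = cover′ }
    where
    cover′ : H ⊑ (H ⊓ V) ⟨ h ⟩
    cover′ x∈H with ⋖-exchange V⋖W (H⊑W h∈H) h∉V (H⊑W x∈H)
    ... | v , w , v∈V , w∈Kh , e = v , w ,
      (cancel∈ H (resp H e x∈H) (line-least H h∈H w∈Kh) , v∈V) , w∈Kh , e

  -- A composition series of length n; working with it avoids coordinates.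
  data Dim : Subspace → ℕ → Set (lsuc (c ⊔ ℓ)) where
    trivial : ∀ {W} → set W ⊆ (_≈ 0#) → Dim W 0
    extend  : ∀ {V W n} → V ⋖ W → Dim V n → Dim W (suc n)

  ⋖-resp : ∀ {V V′ W W′} → V ⊑ V′ → V′ ⊑ V → W ⊑ W′ → W′ ⊑ W → V ⋖ W → V′ ⋖ W′
  ⋖-resp {V} {V′} p q r s V⋖W = record
    { top = top ; below = r ∘ below ∘ q ; top∈ = r top∈ ; top∉ = top∉ ∘ q
    ; cover = ⟨⟩-least V (V′ ⟨ top ⟩) (⊞-inˡ V′ (line top) ∘ p) (⟨⟩-in V′ top) ∘ cover ∘ s }
    where open _⋖_ V⋖W

  Dim-resp : ∀ {V W n} → V ⊑ W → W ⊑ V → Dim V n → Dim W n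
  Dim-resp p q (trivial z)  = trivial (z ∘ q)
  Dim-resp p q (extend r d) = extend (⋖-resp (λ x → x) (λ x → x) p q r) d

  -- Intersecting H with the composition series of W gives one for H, since each step either stalls
  -- or is again a covering; a series that never stalls ends at H = W.
  Dim-⊑ : ∀ {W n} H → H ⊑ W → Dim W n → ∃ λ m → m ≤ n × Dim H m × (m ≡ n → W ⊑ H)
  Dim-⊑ {W} H H⊑W (trivial z) =
    0 , z≤n , trivial (z ∘ H⊑W) , λ _ p → resp H (sym (z p)) (0-closed H)
  Dim-⊑ {W} H H⊑W (extend {V} V⋖W dV) with ⊆-or-∉ (set H) (set V)
  ... | inj₁ H⊑V with Dim-⊑ H H⊑V dV
  ...   | m , m≤n , dH , _ =
    m , ℕ.m≤n⇒m≤1+n m≤n , dH , λ m≡1+n → contradiction (≡.subst (_≤ _) m≡1+n m≤n) ℕ.1+n≰n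
  Dim-⊑ {W} H H⊑W (extend {V} V⋖W dV) | inj₂ (h , h∈H , h∉V)
    with Dim-⊑ (H ⊓ V) proj₂ dV
  ...   | m , m≤n , dHV , eq =
    suc m , s≤s m≤n , extend (⋖-⊓ H V⋖W H⊑W h∈H h∉V) dHV ,
    λ e → ⟨⟩-least V H (proj₁ ∘ eq (ℕ.suc-injective e)) h∈H ∘ ⋖-exchange V⋖W (H⊑W h∈H) h∉V

  -- As in the Jordan-Hölder theorem: two distinct hyperplanes H and V of W meet in a hyperplane of
  -- both, so the series is rerouted from V to H through their intersection.
  Dim-⋖ : ∀ {H W n} → H ⋖ W → Dim W n → ∃ λ m → n ≡ suc m × Dim H m
  Dim-⋖ {H} H⋖W (trivial z) =
    contradiction (resp H (sym (z (_⋖_.top∈ H⋖W))) (0-closed H)) (_⋖_.top∉ H⋖W)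
  Dim-⋖ {H} {W} H⋖W (extend {V} V⋖W dV)
    with ⊆-or-∉ (set V) (set H) | ⊆-or-∉ (set H) (set V)
  ... | inj₁ V⊑H | inj₁ H⊑V = _ , ≡.refl , Dim-resp V⊑H H⊑V dV
  -- Nested hyperplanes coincide: a vector of the larger outside the smaller would already generate
  -- W over the smaller.
  ... | inj₁ V⊑H | inj₂ (h , h∈H , h∉V) = contradiction
    (⟨⟩-least V H V⊑H h∈H (⋖-exchange V⋖W (below h∈H) h∉V top∈)) top∉
    where open _⋖_ H⋖W
  ... | inj₂ (v , v∈V , v∉H) | inj₁ H⊑V = contradiction
    (⟨⟩-least H V H⊑V v∈V (⋖-exchange H⋖W (below v∈V) v∉H top∈)) top∉
    where open _⋖_ V⋖W
  ... | inj₂ (v , v∈V , v∉H) | inj₂ (h , h∈H , h∉V)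
    with Dim-⋖ (⋖-⊓ V H⋖W (_⋖_.below V⋖W) v∈V v∉H) dV
  ...   | m , ≡.refl , dVH = suc m , ≡.refl ,
    extend (⋖-⊓ H V⋖W (_⋖_.below H⋖W) h∈H h∉V)
           (Dim-resp (λ (p , q) → q , p) (λ (p , q) → q , p) dVH)

  Dim-unique : ∀ {W m n} → Dim W m → Dim W n → n ≡ m
  Dim-unique (trivial z) (trivial _) = ≡.refl
  Dim-unique {W} (trivial z) (extend {V} r _) =
    contradiction (resp V (sym (z (_⋖_.top∈ r))) (0-closed V)) (_⋖_.top∉ r)
  Dim-unique (extend r d) d′ with Dim-⋖ r d′
  ... | _ , ≡.refl , d″ = ≡.cong suc (Dim-unique d d″)

  Dim-mono : ∀ {H W m n} → H ⊑ W → Dim H m → Dim W n → m ≤ n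
  Dim-mono {H} H⊑W dH dW with Dim-⊑ H H⊑W dW
  ... | _ , m≤n , dH′ , _ = ≡.subst (_≤ _) (Dim-unique dH dH′) m≤n

  Dim-full : ∀ {H W m n} → H ⊑ W → Dim H m → Dim W n → n ≤ m → W ⊑ H
  Dim-full {H} H⊑W dH dW n≤m with Dim-⊑ H H⊑W dW
  ... | _ , m≤n , dH′ , eq with Dim-unique dH dH′
  ...   | ≡.refl = eq (ℕ.≤-antisym m≤n n≤m)

  -- Induction on the series of W: each new `top` raises the dimension of exactly one of the sum and
  -- the intersection.
  Dim-modular : ∀ {V W m n} → Dim V m → Dim W n →
    ∃₂ λ i j → Dim (V ⊓ W) i × Dim (V ⊞ W) j × i ℕ.+ j ≡ m ℕ.+ n
  Dim-modular {V} {W} {m} dV (trivial z) =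
    0 , m , trivial (z ∘ proj₂) ,
    Dim-resp (⊞-inˡ V W) (⊞-least V W V (λ p → p) λ p → resp V (sym (z p)) (0-closed V)) dV ,
    ≡.sym (ℕ.+-identityʳ m)
  Dim-modular {V} {W} {m} {suc n} dV (extend {W′} r dW′) with Dim-modular dV dW′
  ... | i , j , dI , dS , eq with em {P = _⋖_.top r ∈ set (V ⊞ W′)}
  -- The sum grows. The intersection does not: a vector of V ⊓ W outside W′ would generate W over W′
  -- and put `top` into V ⊞ W′.
  ...   | no x∉V⊞W′ = i , suc j ,
    Dim-resp (λ (p , q) → p , below q) ⊓⊑ dI ,
    Dim-resp (⟨⟩-least (V ⊞ W′) (V ⊞ W)
               (⊞-least V W′ (V ⊞ W) (⊞-inˡ V W) (⊞-inʳ V W ∘ below)) (⊞-inʳ V W top∈))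
             (⊞-least V W X (⊞-inˡ S (line top) ∘ ⊞-inˡ V W′) W⊑X)
             (extend (⋖-intro S x∉V⊞W′) dS) ,
    ≡.trans (ℕ.+-suc i j) (≡.trans (≡.cong suc eq) (≡.sym (ℕ.+-suc m n)))
    where
    open _⋖_ r
    S = V ⊞ W′
    X = S ⟨ top ⟩
    W⊑X : W ⊑ X
    W⊑X = ⟨⟩-least W′ X (⊞-inˡ S (line top) ∘ ⊞-inʳ V W′) (⟨⟩-in S top) ∘ cover
    ⊓⊑ : V ⊓ W ⊑ V ⊓ W′
    ⊓⊑ {y} (y∈V , y∈W) = y∈V , decidable-stable em λ y∉W′ →
      x∉V⊞W′ (⟨⟩-least W′ S (⊞-inʳ V W′) (⊞-inˡ V W′ y∈V) (⋖-exchange r y∈W y∉W′ top∈))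
  -- The sum is unchanged. The component v of `top` lies in V ⊓ W but not in W′, so it extends the
  -- intersection.
  ...   | yes (v , w , v∈V , w∈W′ , x≈v+w) = suc i , j ,
    extend (⋖-resp (λ ((p , _) , q) → p , q) (λ (p , q) → (p , below q) , q) (λ p → p) (λ p → p) ⊓⋖) dI ,
    Dim-resp (⊞-least V W′ (V ⊞ W) (⊞-inˡ V W) (⊞-inʳ V W ∘ below))
             (⊞-least V W S (⊞-inˡ V W′) (⟨⟩-least W′ S (⊞-inʳ V W′) (v , w , v∈V , w∈W′ , x≈v+w) ∘ cover)) dS ,
    ≡.trans (≡.cong suc eq) (≡.sym (ℕ.+-suc m n))
    where
    open _⋖_ r
    S = V ⊞ W′
    v∈W : v ∈ set W
    v∈W = cancel∈ W (resp W x≈v+w top∈) (below w∈W′)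
    v∉W′ : v ∉ set W′
    v∉W′ v∈W′ = top∉ (resp W′ (sym x≈v+w) (+-closed W′ v∈W′ w∈W′))
    ⊓⋖ : (V ⊓ W) ⊓ W′ ⋖ V ⊓ W
    ⊓⋖ = ⋖-⊓ (V ⊓ W) r proj₂ (v∈V , v∈W) v∉W′

  Dim-preimage : ∀ {x V n} → ¬ x ≈ 0# → Dim V n → Dim (preimage x V) n
  Dim-preimage x≉0 (trivial z) = trivial λ p →
    trans (sym (inverse-cancelˡ _ x≉0)) (trans (*-congˡ (z p)) (zeroʳ _))
  Dim-preimage {x} {W} x≉0 (extend {V} r d) = extend (record
    { top   = x ⁻¹ * top
    ; below = below
    ; top∈  = resp W (sym x[x⁻¹t]≈t) top∈
    ; top∉  = top∉ ∘ resp V x[x⁻¹t]≈t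
    ; cover = λ {y} xy∈W → let (v , w , v∈V , (k , k∈K , w≈kt) , xy≈v+w) = cover xy∈W in
        x ⁻¹ * v , x ⁻¹ * w ,
        resp V (sym (inverse-cancelʳ v x≉0)) v∈V ,
        (k , k∈K , trans (*-congˡ w≈kt) (x*yz≈y*xz _ k top)) ,
        trans (sym (inverse-cancelˡ y x≉0)) (trans (*-congˡ xy≈v+w) (distribˡ _ v w))
    }) (Dim-preimage x≉0 d)
    where
    open _⋖_ r
    x[x⁻¹t]≈t = inverse-cancelʳ top x≉0

  -- Spans and bases

  sum∈ : ∀ V {n} {t : Vector Carrier n} → (∀ i → t i ∈ set V) → sum t ∈ set V
  sum∈ V {zero}  t∈V = 0-closed V
  sum∈ V {suc n} t∈V = +-closed V (t∈V zero) (sum∈ V (λ i → t∈V (suc i)))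

  sum-0* : ∀ {n} (v : Vector Carrier n) → sum (λ i → 0# * v i) ≈ 0#
  sum-0* {n} v = trans (sum-cong-≋ (λ i → zeroˡ (v i))) (sum-replicate-zero n)

  -- One coefficient per vector, whereas `Span (Range v)` admits combinations of any length with
  -- repetitions; `Span⊆span` and `span⊆Span` identify the two.
  span : ∀ {n} → Vector Carrier n → Subspace
  span {n} v = record
    { set = λ x → ∃ λ (k : Vector Carrier n) → (∀ i → k i ∈ K) × x ≈ sum (λ i → k i * v i)
    ; isSubspace = record
      { resp     = λ e (k , k∈K , e′) → k , k∈K , trans (sym e) e′
      ; 0-closed = (λ _ → 0#) , (λ _ → 𝕂.0-closed) , sym (sum-0* v)
      ; +-closed = λ (k , k∈K , e) (k′ , k′∈K , e′) →
          (λ i → k i + k′ i) , (λ i → 𝕂.+-closed (k∈K i) (k′∈K i)) ,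
          trans (+-cong e e′) (trans (sym (∑-distrib-+ (λ i → k i * v i) (λ i → k′ i * v i)))
            (sum-cong-≋ λ i → sym (distribʳ (v i) (k i) (k′ i))))
      ; ·-closed = λ {l} l∈K (k , k∈K , e) →
          (λ i → l * k i) , (λ i → 𝕂.*-closed l∈K (k∈K i)) ,
          trans (*-congˡ e) (trans (*-distribˡ-sum l (λ i → k i * v i))
            (sum-cong-≋ λ i → sym (*-assoc l (k i) (v i))))
      }
    }

  ∷-∈ : ∀ X {x n} {v : Vector Carrier n} → x ∈ set X → (∀ i → v i ∈ set X) →
    ∀ i → (x Vector.∷ v) i ∈ set X
  ∷-∈ X x∈X v∈X zero    = x∈X
  ∷-∈ X x∈X v∈X (suc i) = v∈X i

  span-least : ∀ {n} {v : Vector Carrier n} X → (∀ i → v i ∈ set X) → span v ⊑ X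
  span-least X v∈X (k , k∈K , e) = resp X (sym e) (sum∈ X λ i → ·-closed X (k∈K i) (v∈X i))

  span-head : ∀ {n} (v : Vector Carrier (suc n)) → head v ∈ set (span v)
  span-head v = 1# Vector.∷ (λ _ → 0#) ,
    (λ { zero → 𝕂.1-closed ; (suc _) → 𝕂.0-closed }) ,
    sym (trans (+-cong (*-identityˡ _) (sum-0* (tail v))) (+-identityʳ _))

  span-tail : ∀ {n} (v : Vector Carrier (suc n)) → span (tail v) ⊑ span v
  span-tail v (k , k∈K , e) = 0# Vector.∷ k ,
    (λ { zero → 𝕂.0-closed ; (suc i) → k∈K i }) ,
    trans e (sym (trans (+-congʳ (zeroˡ _)) (+-identityˡ _)))

  ∈-span : ∀ {n} (v : Vector Carrier n) i → v i ∈ set (span v)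
  ∈-span v zero    = span-head v
  ∈-span v (suc i) = span-tail v (∈-span (tail v) i)

  span-uncons : ∀ {n} (v : Vector Carrier (suc n)) → span v ⊑ span (tail v) ⟨ head v ⟩
  span-uncons v (k , k∈K , e) = _ , _ ,
    (tail k , k∈K ∘ suc , refl) , (head k , k∈K zero , refl) , trans e (+-comm _ _)

  Span⊆span : ∀ {n} (v : Vector Carrier n) → Span (Range v) ⊆ set (span v)
  Span⊆span v (_ , k , w , k∈K , w∈v , e) = resp (span v) (sym e) (sum∈ (span v) λ j →
    ·-closed (span v) (k∈K j)
      (resp (span v) (sym (proj₂ (w∈v j))) (∈-span v (proj₁ (w∈v j)))))

  span⊆Span : ∀ {n} (v : Vector Carrier n) → set (span v) ⊆ Span (Range v)
  span⊆Span v (k , k∈K , e) = _ , k , v , k∈K , (λ i → i , refl) , e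

  LI-head : ∀ {n} {v : Vector Carrier (suc n)} →
    LinearlyIndependent v → head v ∉ set (span (tail v))
  LI-head {v = v} li (k , k∈K , e) =
    1≉0 (trans (sym (+-identityʳ 1#)) (trans (+-congˡ (sym -1≈0)) (-‿inverseʳ 1#)))
    where
    -1≈0 : - 1# ≈ 0#
    -- Writing `head v` through the tail gives a relation with leading coefficient -1, which
    -- independence would force to be 0.
    -1≈0 = li (- 1# Vector.∷ k) (λ { zero → -1∈K ; (suc i) → k∈K i })
      (trans (+-cong (-1*x≈-x _) (sym e)) (-‿inverseˡ _)) zero

  LI-tail : ∀ {n} {v : Vector Carrier (suc n)} →
    LinearlyIndependent v → LinearlyIndependent (tail v)
  LI-tail li k k∈K e i = li (0# Vector.∷ k) (λ { zero → 𝕂.0-closed ; (suc i) → k∈K i })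
    (trans (+-cong (zeroˡ _) e) (+-identityˡ _)) (suc i)

  LI-∷ : ∀ {n x} {v : Vector Carrier n} →
    LinearlyIndependent v → x ∉ set (span v) → LinearlyIndependent (x Vector.∷ v)
  LI-∷ {n} {x} {v} li x∉v k k∈K e = λ { zero → k₀≈0 ; (suc i) → k₊≈0 i }
    where
    rest = sum (λ i → k (suc i) * v i)
    k₀≈0 : k zero ≈ 0#
    k₀≈0 = decidable-stable em λ k₀≉0 → x∉v (unscale∈ (span v) (k∈K zero) k₀≉0
      (cancel∈ (span v) (resp (span v) (sym e) (0-closed (span v)))
        (tail k , k∈K ∘ suc , refl)))
    k₊≈0 = li (tail k) (k∈K ∘ suc)
      (trans (sym (trans (+-congʳ (trans (*-congʳ k₀≈0) (zeroˡ x))) (+-identityˡ rest))) e)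

  Dim-span : ∀ {n} (v : Vector Carrier n) → LinearlyIndependent v → Dim (span v) n
  Dim-span {zero}  v li = trivial λ (_ , _ , e) → e
  Dim-span {suc n} v li = extend
    (record { top = head v ; below = span-tail v ; top∈ = span-head v
            ; top∉ = LI-head {v = v} li ; cover = span-uncons v })
    (Dim-span (tail v) (LI-tail {v = v} li))

  Dim-basis : ∀ {n} V {v : Vector Carrier n} → IsBasis v (set V) → Dim V n
  Dim-basis V {v} (li , Span⊆V , V⊆Span) =
    Dim-resp (Span⊆V ∘ span⊆Span v) (Span⊆span v ∘ V⊆Span) (Dim-span v li)

  -- The tops of a composition series form a basis, as each lies outside the span of those below it.
  Dim⇒HasDim : ∀ {V n} → Dim V n → HasDim (set V) n
  Dim⇒HasDim {V} (trivial z) = (λ ()) , (λ _ _ _ ()) ,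
    (λ p → span-least {v = λ ()} V (λ ()) (Span⊆span (λ ()) p)) , λ p → 0 , (λ ()) , (λ ()) , (λ ()) , (λ ()) , z p
  Dim⇒HasDim {W} (extend {V} r d) =
    let v , li , Span⊆V , V⊆Span = Dim⇒HasDim d
        w = top Vector.∷ v
        v⊆V : span v ⊑ V
        v⊆V = Span⊆V ∘ span⊆Span v
    in w , LI-∷ li (top∉ ∘ v⊆V) ,
       (λ p → span-least {v = w} W
          (∷-∈ W top∈ λ i → below (v⊆V (∈-span v i))) (Span⊆span w p)) ,
       (λ p → span⊆Span w (⟨⟩-least V (span w)
          (span-tail w ∘ Span⊆span v ∘ V⊆Span) (span-head w) (cover p)))
    where open _⋖_ r

  isolate∈ : ∀ {n} H (i : Fin (suc n)) (k v : Vector Carrier (suc n)) → (∀ j → k j ∈ K) →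
    (∀ j → v (punchIn i j) ∈ set H) → sum (λ j → k j * v j) ∈ set H → k i * v i ∈ set H
  isolate∈ H i k v k∈K v∈H s∈H = cancel∈ H
    (resp H (sum-remove {i = i} (λ j → k j * v j)) s∈H)
    (sum∈ H λ j → ·-closed H (k∈K (punchIn i j)) (v∈H j))

  -- Rado's theorem for hyperplanes

  Family : ℕ → Set (lsuc (c ⊔ ℓ))
  Family n = Fin n → Subspace

  -- The ambient E makes the meet over the empty index set equal to E, so that every meet is
  -- finite-dimensional when E is.
  meet : ∀ {n} → Subspace → Family n → Fin.Subset n → Subspace
  meet E F J = record
    { set = λ x → x ∈ set E × (∀ j → j Fin.∈ J → x ∈ set (F j))
    ; isSubspace = record
      { resp     = λ e (p , q) → resp E e p , λ j j∈J → resp (F j) e (q j j∈J)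
      ; 0-closed = 0-closed E , λ j _ → 0-closed (F j)
      ; +-closed = λ (p , q) (p′ , q′) →
          +-closed E p p′ , λ j j∈J → +-closed (F j) (q j j∈J) (q′ j j∈J)
      ; ·-closed = λ k∈K (p , q) → ·-closed E k∈K p , λ j j∈J → ·-closed (F j) k∈K (q j j∈J)
      }
    }

  -- For dim E = n, the annihilator of the meet in the dual of E has dimension n - d. The inequality
  -- is thus Rado's condition for an independent transversal of the annihilators.
  RadoCondition : ∀ {n} → Subspace → Family n → Set (lsuc (c ⊔ ℓ))
  RadoCondition {n} E F = ∀ J {d} → Dim (meet E F J) d → d ℕ.+ ∣ J ∣ ≤ n

  -- Vacuous when E ⊑ V, so that E itself and its hyperplanes are covered without a case
  -- distinction.
  Codim≤1 : Subspace → Subspace → Set (c ⊔ ℓ)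
  Codim≤1 E V = ∀ {x} → x ∈ set E → x ∉ set V → E ⊑ V ⟨ x ⟩

  infixl 9 _[_≔_]
  _[_≔_] : ∀ {n} → Family n → Fin n → Subspace → Family n
  F [ i ≔ V ] = updateAt F i (λ _ → V)

  [≔]-elim : ∀ {a n} {F : Family n} {i V} (R : Fin n → Subspace → Set a) →
    R i V → (∀ j → R j (F j)) → ∀ j → R j ((F [ i ≔ V ]) j)
  [≔]-elim {F = F} {i} R RiV RF j with j ≟ i
  ... | yes ≡.refl = ≡.subst (R j) (≡.sym (updateAt-updates i F)) RiV
  ... | no  j≢i    = ≡.subst (R j) (≡.sym (updateAt-minimal j i F j≢i)) (RF j)

  module _ {n} {E : Subspace} (dE : Dim E n) where

    violation : ∀ (F : Family n) → ¬ RadoCondition E F →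
      ∃₂ λ J d → Dim (meet E F J) d × n < d ℕ.+ ∣ J ∣
    violation F ¬rado = decidable-stable em λ ¬v →
      ¬rado λ J {d} dJ → ℕ.≮⇒≥ λ lt → ¬v (J , d , dJ , lt)

    module _ {F : Family n} (rado : RadoCondition E F) (i : Fin n) where

      -- If i ∉ J, the replacement does not affect the meet over J, and the condition for `F` would
      -- already be violated.
      violation-∋ : ∀ {V J d} → Dim (meet E (F [ i ≔ V ]) J) d → n < d ℕ.+ ∣ J ∣ → i Fin.∈ J
      violation-∋ {V} {J} {d} dJ lt with i Fin.∈? J
      ... | yes i∈J = i∈J
      ... | no  i∉J =
        let _ , _ , dFJ , _ = Dim-⊑ (meet E F J) proj₁ dE
            sub : meet E (F [ i ≔ V ]) J ⊑ meet E F J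
            sub = λ (p , q) → p , λ j j∈J → ≡.subst (λ W → _ ∈ set W)
              (updateAt-minimal j i F λ { ≡.refl → i∉J j∈J }) (q j j∈J)
        in contradiction lt (ℕ.≤⇒≯ (ℕ.≤-trans
             (ℕ.+-monoˡ-≤ ∣ J ∣ (Dim-mono sub dJ dFJ)) (rado J dFJ)))

      -- Two violating index sets J₁, J₂ contain i, and submodularity of the
      -- dimension then contradicts the condition for J₁ ∪ J₂ and (J₁ ∩ J₂) - i.
      rado-split : ∀ {V₁ V₂} → V₁ ⊓ V₂ ⊑ F i →
        RadoCondition E (F [ i ≔ V₁ ]) ⊎ RadoCondition E (F [ i ≔ V₂ ])
      rado-split {V₁} {V₂} V₁⊓V₂⊑
        with em {P = RadoCondition E (F [ i ≔ V₁ ])} | em {P = RadoCondition E (F [ i ≔ V₂ ])}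
      ... | yes r₁ | _      = inj₁ r₁
      ... | no _   | yes r₂ = inj₂ r₂
      ... | no ¬r₁ | no ¬r₂ with violation (F [ i ≔ V₁ ]) ¬r₁ | violation (F [ i ≔ V₂ ]) ¬r₂
      ...   | J₁ , d₁ , dP , lt₁ | J₂ , d₂ , dQ , lt₂ =
        let _ , _ , dI , dS , eq = Dim-modular dP dQ
            _ , _ , dI′ , _ = Dim-⊑ (meet E F (J₁ Fin.∪ J₂)) proj₁ dE
            _ , _ , dS′ , _ = Dim-⊑ (meet E F (J₁ Fin.∩ J₂ Fin.- i)) proj₁ dE
        in contradiction lt₂ (submodular-bound {j₁ = ∣ J₁ ∣} eq (∣p∪q∣+∣p∩q∣ J₁ J₂) (∣p∣≤1+∣p-x∣ (J₁ Fin.∩ J₂) i)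
             (ℕ.≤-trans (ℕ.+-monoˡ-≤ _ (Dim-mono ⊓-sub dI dI′)) (rado (J₁ Fin.∪ J₂) dI′))
             (ℕ.≤-trans (ℕ.+-monoˡ-≤ _ (Dim-mono ⊞-sub dS dS′)) (rado (J₁ Fin.∩ J₂ Fin.- i) dS′))
             lt₁)
        where
        P = meet E (F [ i ≔ V₁ ]) J₁
        Q = meet E (F [ i ≔ V₂ ]) J₂
        at-i : ∀ {V J x} → i Fin.∈ J → x ∈ set (meet E (F [ i ≔ V ]) J) → x ∈ set V
        at-i {x = x} i∈J (_ , q) = ≡.subst (λ W → x ∈ set W) (updateAt-updates i F) (q i i∈J)
        off-i : ∀ {V J x j} → j ≢ i → j Fin.∈ J → x ∈ set (meet E (F [ i ≔ V ]) J) → x ∈ set (F j)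
        off-i {x = x} {j} j≢i j∈J (_ , q) =
          ≡.subst (λ W → x ∈ set W) (updateAt-minimal j i F j≢i) (q j j∈J)
        ⊓-sub : P ⊓ Q ⊑ meet E F (J₁ Fin.∪ J₂)
        ⊓-sub {x} (x∈P , x∈Q) = proj₁ x∈P , λ j j∈J → go j (Fin.x∈p∪q⁻ J₁ J₂ j∈J)
          where
          go : ∀ j → j Fin.∈ J₁ ⊎ j Fin.∈ J₂ → x ∈ set (F j)
          go j j∈ with j ≟ i
          go j j∈         | yes ≡.refl = V₁⊓V₂⊑
            (at-i {V₁} (violation-∋ {V₁} dP lt₁) x∈P , at-i {V₂} (violation-∋ {V₂} dQ lt₂) x∈Q)
          go j (inj₁ j∈J) | no j≢i = off-i {V₁} j≢i j∈J x∈P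
          go j (inj₂ j∈J) | no j≢i = off-i {V₂} j≢i j∈J x∈Q
        J∩ = J₁ Fin.∩ J₂ Fin.- i
        split : ∀ {j} → j Fin.∈ J∩ → j ≢ i × j Fin.∈ J₁ × j Fin.∈ J₂
        split j∈ = (λ { ≡.refl → x∉p-x (J₁ Fin.∩ J₂) i j∈ }) ,
          Fin.x∈p∩q⁻ J₁ J₂ (Fin.p─q⊆p (J₁ Fin.∩ J₂) ⁅ i ⁆ j∈)
        ⊞-sub : P ⊞ Q ⊑ meet E F J∩
        ⊞-sub = ⊞-least P Q (meet E F J∩)
          (λ x∈P → proj₁ x∈P , λ j j∈ → let j≢i , j∈J₁ , _ = split j∈ in off-i {V₁} j≢i j∈J₁ x∈P)
          (λ x∈Q → proj₁ x∈Q , λ j j∈ → let j≢i , _ , j∈J₂ = split j∈ in off-i {V₂} j≢i j∈J₂ x∈Q)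

    -- The field `codim≤1` protects the positions already treated while another one is enlarged.
    record Enlargement (F G : Family n) : Set (lsuc (c ⊔ ℓ)) where
      field
        G⊑E    : ∀ j → G j ⊑ E
        rado   : RadoCondition E G
        F⊑G    : ∀ j → F j ⊑ G j
        codim≤1 : ∀ j → Codim≤1 E (F j) → Codim≤1 E (G j)

    open Enlargement

    Enlargement-refl : ∀ {F} → (∀ j → F j ⊑ E) → RadoCondition E F → Enlargement F F
    Enlargement-refl F⊑E r = record
      { G⊑E = F⊑E ; rado = r ; F⊑G = λ _ p → p ; codim≤1 = λ _ p → p }

    Enlargement-trans : ∀ {F G H} → Enlargement F G → Enlargement G H → Enlargement F H
    Enlargement-trans p q = record
      { G⊑E = G⊑E q ; rado = rado q ; F⊑G = λ j → F⊑G q j ∘ F⊑G p j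
      ; codim≤1 = λ j r → codim≤1 q j (codim≤1 p j r) }

    -- A common vector z outside V would, by exchange, give y ∈ V⟨z⟩ ⊆ V⟨x⟩.
    ⟨⟩-⊓-⟨⟩ : ∀ V {x y} → y ∉ set (V ⟨ x ⟩) → V ⟨ x ⟩ ⊓ V ⟨ y ⟩ ⊑ V
    ⟨⟩-⊓-⟨⟩ V {x} {y} y∉ {z} (z∈₁ , z∈₂) = decidable-stable em λ z∉V →
      y∉ (⟨⟩-least V (V ⟨ x ⟩) (⊞-inˡ V (line x)) z∈₁ (⟨⟩-exchange V z∈₂ z∉V))

    insert-enlarges : ∀ {F i z} → (∀ j → F j ⊑ E) → z ∈ set E →
      RadoCondition E (F [ i ≔ F i ⟨ z ⟩ ]) → Enlargement F (F [ i ≔ F i ⟨ z ⟩ ])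
    insert-enlarges {F} {i} {z} F⊑E z∈E r = record
      { G⊑E     = [≔]-elim {F = F} (λ _ V → V ⊑ E) (⟨⟩-least (F i) E (F⊑E i) z∈E) F⊑E
      ; rado    = r
      ; F⊑G     = [≔]-elim {F = F} (λ j V → F j ⊑ V) (⊞-inˡ (F i) (line z)) (λ _ p → p)
      ; codim≤1 = [≔]-elim {F = F} (λ j V → Codim≤1 E (F j) → Codim≤1 E V) at-i (λ _ h → h)
      }
      where
      at-i : Codim≤1 E (F i) → Codim≤1 E (F i ⟨ z ⟩)
      at-i h {x} x∈E x∉ y∈E = ⟨⟩-least (F i) (F i ⟨ z ⟩ ⟨ x ⟩)
        (⊞-inˡ (F i ⟨ z ⟩) (line x) ∘ ⊞-inˡ (F i) (line z)) (⟨⟩-in (F i ⟨ z ⟩) x)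
        (h x∈E (x∉ ∘ ⊞-inˡ (F i) (line z)) y∈E)

    -- `fuel` bounds the codimension of F i. Unless that is at most 1, there are x and y in E
    -- independent modulo F i; then F i is the intersection of F i + Kx and F i + Ky, and
    -- `rado-split` allows one of these as replacement.
    enlarge-at : ∀ fuel (F : Family n) i {d} → (∀ j → F j ⊑ E) → RadoCondition E F →
      Dim (F i) d → n ≤ d ℕ.+ fuel → ∃ λ G → Enlargement F G × Codim≤1 E (G i)
    -- Without fuel, F i has full dimension and equals E, so no vector of E lies outside it.
    enlarge-at zero F i F⊑E r dF n≤d = F , Enlargement-refl F⊑E r ,
      λ x∈E x∉F → contradiction
        (Dim-full (F⊑E i) dF dE (≡.subst (n ≤_) (ℕ.+-identityʳ _) n≤d) x∈E) x∉F
    enlarge-at (suc fuel) F i {d} F⊑E r dF n≤ with em {P = Codim≤1 E (F i)}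
    ... | yes h = F , Enlargement-refl F⊑E r , h
    ... | no ¬h with em {P = ∃₂ λ x y → x ∈ set E × y ∈ set E × x ∉ set (F i) × y ∉ set (F i ⟨ x ⟩)}
    ...   | no ¬w = contradiction (λ {x} x∈E x∉F {y} y∈E →
                      decidable-stable em λ y∉ → ¬w (x , y , x∈E , y∈E , x∉F , y∉)) ¬h
    ...   | yes (x , y , x∈E , y∈E , x∉F , y∉) =
      [ continue x∈E x∉F , continue y∈E (y∉ ∘ ⊞-inˡ (F i) (line x)) ]′
        (rado-split r i (⟨⟩-⊓-⟨⟩ (F i) y∉))
      where
      continue : ∀ {z} → z ∈ set E → z ∉ set (F i) → RadoCondition E (F [ i ≔ F i ⟨ z ⟩ ]) →
        ∃ λ G → Enlargement F G × Codim≤1 E (G i)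
      continue {z} z∈E z∉F r′ =
        let p = insert-enlarges F⊑E z∈E r′
            G , q , h = enlarge-at fuel (F [ i ≔ F i ⟨ z ⟩ ]) i (G⊑E p) r′
              (≡.subst (λ V → Dim V (suc d)) (≡.sym (updateAt-updates i F)) (extend (⋖-intro (F i) z∉F) dF))
              (≡.subst (n ≤_) (ℕ.+-suc d fuel) n≤)
        in G , Enlargement-trans p q , h

    -- `ι` lists the positions to be treated, so the recursion runs on m while the family stays
    -- indexed by `Fin n`.
    enlarge : ∀ {m} (ι : Fin m → Fin n) (F : Family n) → (∀ j → F j ⊑ E) → RadoCondition E F →
      ∃ λ G → Enlargement F G × (∀ k → Codim≤1 E (G (ι k)))
    enlarge {zero}  ι F F⊑E r = F , Enlargement-refl F⊑E r , λ ()
    enlarge {suc m} ι F F⊑E r =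
      let G , p , hG = enlarge (ι ∘ suc) F F⊑E r
          _ , _ , dG , _ = Dim-⊑ (G (ι zero)) (G⊑E p (ι zero)) dE
          H , q , hH = enlarge-at n G (ι zero) (G⊑E p) (rado p) dG (ℕ.m≤n+m n _)
      in H , Enlargement-trans p q , λ { zero → hH ; (suc k) → codim≤1 q (ι (suc k)) (hG k) }

    -- Each further member either contains the meet of the others or cuts a hyperplane out of it, so
    -- it costs at most one dimension.
    codim≤1-meet : ∀ {m d} (F : Family m) → (∀ j → Codim≤1 E (F j)) →
      Dim (meet E F Fin.⊤) d → n ≤ d ℕ.+ m
    codim≤1-meet {zero} {d} F h dM = ≡.subst (n ≤_) (≡.sym (ℕ.+-identityʳ d))
      (Dim-mono (λ p → p , λ ()) dE dM)
    codim≤1-meet {suc m} {d} F h dM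
      with Dim-⊑ (meet E (F ∘ suc) Fin.⊤) proj₁ dE
    ... | e , _ , dW , _ with codim≤1-meet (F ∘ suc) (h ∘ suc) dW
                            | ⊆-or-∉ (set (meet E (F ∘ suc) Fin.⊤)) (set (F zero))
    ...   | n≤e+m | inj₁ W⊑F₀ = ℕ.≤-trans n≤e+m
      (ℕ.+-mono-≤ (Dim-mono (λ p → proj₁ p , λ { zero _ → W⊑F₀ p ; (suc j) _ → proj₂ p j Fin.∈⊤ }) dW dM)
                  (ℕ.n≤1+n m))
    ...   | n≤e+m | inj₂ (w , w∈W , w∉F₀)
      with Dim-⋖ (⋖-⊓ (meet E (F ∘ suc) Fin.⊤) (⋖-intro (F zero) w∉F₀)
                      (h zero (proj₁ w∈W) w∉F₀ ∘ proj₁) w∈W w∉F₀) dW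
    ...     | e′ , ≡.refl , dWF = ℕ.≤-trans n≤e+m (ℕ.≤-trans (ℕ.≤-reflexive (≡.sym (ℕ.+-suc e′ m)))
      (ℕ.+-monoˡ-≤ (suc m) (Dim-mono
        (λ (p , q) → proj₁ p , λ { zero _ → q ; (suc j) _ → proj₂ p j Fin.∈⊤ }) dWF dM)))

  -- From hyperplanes to a basis

  nonzero-member : ∀ {V n} → Dim V (suc n) → ∃ λ x → x ∈ set V × ¬ x ≈ 0#
  nonzero-member (extend {V} r _) =
    top , top∈ , λ x≈0 → top∉ (resp V (sym x≈0) (0-closed V))
    where open _⋖_ r

  -- A dual basis: bᵢ lies in Fⱼ for all j ≠ i but not in Fᵢ. A combination of the bⱼ that lies in
  -- Fᵢ therefore has i-th coefficient 0, which yields both independence and the inclusion in the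
  -- span of the others.
  hyperplanes⇒basis : ∀ {n E} {F : Family (suc n)} → Dim E (suc n) → (∀ j → F j ⊑ E) →
    RadoCondition E F → (∀ j → Codim≤1 E (F j)) →
    ∃ λ b → IsBasis b (set E) × (∀ i → set (F i) ⊆ Span (RangeExcept b i))
  hyperplanes⇒basis {n} {E} {F} dE F⊑E rado h =
    b , (li , (span-least E b∈E ∘ Span⊆span b) , (span⊆Span b ∘ E⊑span)) , F⊆
    where
    vertex : ∀ i → ∃ λ x → x ∈ set (meet E (F ∘ punchIn i) Fin.⊤) × ¬ x ≈ 0#
    vertex i with Dim-⊑ (meet E (F ∘ punchIn i) Fin.⊤) proj₁ dE
    -- In dimension n + 1, the n members other than Fᵢ cannot meet in 0.
    ... | zero  , _ , d₀ , _ = contradiction (codim≤1-meet dE (F ∘ punchIn i) (h ∘ punchIn i) d₀) ℕ.1+n≰n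
    ... | suc _ , _ , d₊ , _ = nonzero-member d₊

    b : Vector Carrier (suc n)
    b i = proj₁ (vertex i)

    b∈E : ∀ i → b i ∈ set E
    b∈E i = proj₁ (proj₁ (proj₂ (vertex i)))

    b∈F : ∀ {i j} → i ≢ j → b i ∈ set (F j)
    b∈F {i} i≢j = ≡.subst (λ k → b i ∈ set (F k)) (punchIn-punchOut i≢j)
      (proj₂ (proj₁ (proj₂ (vertex i))) (punchOut i≢j) Fin.∈⊤)

    meet≈0 : set (meet E F Fin.⊤) ⊆ (_≈ 0#)
    meet≈0 with Dim-⊑ (meet E F Fin.⊤) proj₁ dE
    ... | zero  , _ , trivial z , _ = z
    -- On the full index set the condition bounds the dimension of the meet plus n + 1 by n + 1,
    -- which rules out positive dimension.
    ... | suc d , _ , dM , _ = contradiction (rado Fin.⊤ dM)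
      (ℕ.<⇒≱ (s≤s (ℕ.≤-trans (ℕ.≤-reflexive (≡.sym (Fin.∣⊤∣≡n (suc n)))) (ℕ.m≤n+m _ d))))

    b∉F : ∀ i → b i ∉ set (F i)
    b∉F i bᵢ∈Fᵢ = proj₂ (proj₂ (vertex i)) (meet≈0 (b∈E i , λ j _ → all j))
      where
      all : ∀ j → b i ∈ set (F j)
      all j with i ≟ j
      ... | yes ≡.refl = bᵢ∈Fᵢ
      ... | no  i≢j    = b∈F i≢j

    coefficient≈0 : ∀ i k → (∀ j → k j ∈ K) →
      sum (λ j → k j * b j) ∈ set (F i) → k i ≈ 0#
    coefficient≈0 i k k∈K s∈F = decidable-stable em λ k≉0 → b∉F i (unscale∈ (F i) (k∈K i) k≉0
      (isolate∈ (F i) i k b k∈K (λ j → b∈F (punchInᵢ≢i i j)) s∈F))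

    li : LinearlyIndependent b
    li k k∈K s≈0 i = coefficient≈0 i k k∈K (resp (F i) (sym s≈0) (0-closed (F i)))

    E⊑span : E ⊑ span b
    E⊑span = Dim-full (span-least E b∈E) (Dim-span b li) dE ℕ.≤-refl

    F⊆ : ∀ i → set (F i) ⊆ Span (RangeExcept b i)
    F⊆ i y∈F with E⊑span (F⊑E i y∈F)
    ... | k , k∈K , y≈s = n , k ∘ punchIn i , b ∘ punchIn i , k∈K ∘ punchIn i ,
      (λ j → punchIn i j , punchInᵢ≢i i j , refl) ,
      trans y≈s (trans (sum-remove {i = i} (λ j → k j * b j)) (trans (+-congʳ
        (trans (*-congʳ (coefficient≈0 i k k∈K (resp (F i) y≈s y∈F))) (zeroˡ (b i))))
        (+-identityˡ _)))

  linear-rado : ∀ {n E} {F : Family (suc n)} → Dim E (suc n) → (∀ j → F j ⊑ E) → RadoCondition E F →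
    ∃ λ b → IsBasis b (set E) × (∀ i → set (F i) ⊆ Span (RangeExcept b i))
  linear-rado {F = F} dE F⊑E r =
    let G , p , h = enlarge dE (λ i → i) F F⊑E r
        open Enlargement p
        b , basis , G⊆ = hyperplanes⇒basis {F = G} dE G⊑E rado h
    in b , basis , λ i → G⊆ i ∘ F⊑G i

  -- The product of two subspaces

  LI⇒≉0 : ∀ {n} (v : Vector Carrier n) → LinearlyIndependent v → ∀ i → ¬ v i ≈ 0#
  LI⇒≉0 v li zero    v₀≈0 = LI-head {v = v} li
    (resp (span (tail v)) (sym v₀≈0) (0-closed (span (tail v))))
  LI⇒≉0 v li (suc i) = LI⇒≉0 (tail v) (LI-tail {v = v} li) i

  -- The base case is the span of the empty family, hence 0; each `inside` adds one line, which
  -- makes the dimension ∣ J ∣ structural.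
  subspan : ∀ {n} → Fin.Subset n → Vector Carrier n → Subspace
  subspan []            v = span v
  subspan (outside ∷ J) v = subspan J (tail v)
  subspan (inside  ∷ J) v = subspan J (tail v) ⟨ head v ⟩

  subspan-least : ∀ {n} (J : Fin.Subset n) {v} X → (∀ j → j Fin.∈ J → v j ∈ set X) →
    subspan J v ⊑ X
  subspan-least []            {v} X v∈X = span-least {v = v} X λ ()
  subspan-least (outside ∷ J) X v∈X = subspan-least J X λ j j∈J → v∈X (suc j) (there j∈J)
  subspan-least (inside  ∷ J) X v∈X = ⟨⟩-least (subspan J _) X
    (subspan-least J X λ j j∈J → v∈X (suc j) (there j∈J)) (v∈X zero here)

  Dim-subspan : ∀ {n} (J : Fin.Subset n) v → LinearlyIndependent v → Dim (subspan J v) ∣ J ∣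
  Dim-subspan []            v li = Dim-span v li
  Dim-subspan (outside ∷ J) v li = Dim-subspan J (tail v) (LI-tail {v = v} li)
  Dim-subspan (inside  ∷ J) v li = extend
    (⋖-intro (subspan J (tail v)) λ v₀∈ → LI-head {v = v} li
      (subspan-least J (span (tail v)) (λ j _ → ∈-span (tail v) j) v₀∈))
    (Dim-subspan J (tail v) (LI-tail {v = v} li))

  Dim-line : ∀ {x} → ¬ x ≈ 0# → Dim (line x) 1
  Dim-line {x} x≉0 = extend {V = span {0} λ ()} (record
    { top   = x
    ; below = λ (_ , _ , y≈0) → resp (line x) (sym y≈0) (0-closed (line x))
    ; top∈  = x∈line x
    ; top∉  = λ (_ , _ , x≈0) → x≉0 x≈0
    ; cover = ⊞-inʳ (span {0} λ ()) (line x)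
    }) (trivial λ (_ , _ , y≈0) → y≈0)

  K⊆line-1 : K ⊆ set (line 1#)
  K⊆line-1 {k} k∈K = k , k∈K , sym (*-identityʳ k)

  line-1⊆K : set (line 1#) ⊆ K
  line-1⊆K (k , k∈K , e) = 𝕂.resp (sym (trans e (*-identityʳ k))) k∈K

  infix 4 _·_⊑_
  -- No product space is formed: a subspace contains the span of all products as soon as it contains
  -- the products.
  _·_⊑_ : Subspace → Subspace → Subspace → Set (c ⊔ ℓ)
  S · T ⊑ A = ∀ {x y} → x ∈ set S → y ∈ set T → x * y ∈ set A

  Nonzero : Subspace → Set (c ⊔ ℓ)
  Nonzero S = ∃ λ x → x ∈ set S × ¬ x ≈ 0#

  -- The pair at which the e-transforms stop. `d` is the preserved total dimension, and `nonzero` is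
  -- what later bounds the degree of the stabiliser of `S′`.
  record StablePair (A T : Subspace) (d : ℕ) : Set (lsuc (c ⊔ ℓ)) where
    field
      {S′ T′}  : Subspace
      {s′ t′}  : ℕ
      Dim-S′   : Dim S′ s′
      Dim-T′   : Dim T′ t′
      s′+t′    : s′ ℕ.+ t′ ≡ d
      nonzero  : Nonzero S′
      S′⊑A     : S′ ⊑ A
      T′⊑T     : T′ ⊑ T
      stable   : S′ · T′ ⊑ S′

  -- The e-transform (S , T) ↦ (S + eT , T ∩ e⁻¹S) with e ∈ S preserves dim S + dim T
  -- and keeps the product inside A; it shrinks T unless eT ⊆ S.
  e-transform : ∀ {A S T s t} → Acc _<_ t → Dim S s → Dim T t → 1# ∈ set T →
    Nonzero S → S · T ⊑ A → StablePair A T (s ℕ.+ t)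
  e-transform {A} {S} {T} {s} {t} (acc rec) dS dT 1∈T S≉0 ST⊑A
    with em {P = ∃₂ λ e y → e ∈ set S × y ∈ set T × e * y ∉ set S}
  ... | no ¬p = record
    { Dim-S′ = dS ; Dim-T′ = dT ; s′+t′ = ≡.refl ; nonzero = S≉0
    ; S′⊑A   = λ x∈S → resp A (*-identityʳ _) (ST⊑A x∈S 1∈T)
    ; T′⊑T   = λ p → p
    ; stable = λ {x} {y} x∈S y∈T → decidable-stable em λ xy∉S → ¬p (x , y , x∈S , y∈T , xy∉S)
    }
  ... | yes (e , y , e∈S , y∈T , ey∉S) =
    let i , j , dI , dJ , i+j = Dim-modular dS (Dim-preimage (inverse-≉0 e≉0) dT)
        dT₁ = Dim-preimage e≉0 dI
        -- If the dimension did not drop, T₁ would be T, and y ∈ T₁ would give ey ∈ S.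
        i<t = ℕ.≰⇒> λ t≤i → ey∉S (proj₁ (Dim-full T₁⊑T dT₁ dT t≤i y∈T))
        open StablePair (e-transform {A} {S ⊞ eT} {T₁} (rec i<t) dJ dT₁
          -- 1 stays in T₁: e · 1 lies in S by the choice of e, and in eT because 1 ∈ T.
          (resp S (sym (*-identityʳ e)) e∈S , resp T (sym (inverse-cancelˡ 1# e≉0)) 1∈T)
          (e , ⊞-inˡ S eT e∈S , e≉0) S₁T₁⊑A)
    in record
      { Dim-S′  = Dim-S′ ; Dim-T′ = Dim-T′
      ; s′+t′   = ≡.trans s′+t′ (≡.trans (ℕ.+-comm j i) i+j)
      ; nonzero = nonzero ; S′⊑A = S′⊑A ; T′⊑T = T₁⊑T ∘ T′⊑T ; stable = stable }
    where
    e≉0 : ¬ e ≈ 0#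
    e≉0 e≈0 = ey∉S (resp S (sym (trans (*-congʳ e≈0) (zeroˡ y))) (0-closed S))
    eT = preimage (e ⁻¹) T
    T₁ = preimage e (S ⊓ eT)
    T₁⊑T : T₁ ⊑ T
    T₁⊑T (_ , p) = resp T (inverse-cancelˡ _ e≉0) p
    S₁T₁⊑A : S ⊞ eT · T₁ ⊑ A
    S₁T₁⊑A {y = z} (v , w , v∈S , w∈eT , x≈v+w) z∈T₁@(ez∈S , _) =
      resp A (sym (trans (*-congʳ x≈v+w) (distribʳ z v w))) (+-closed A
        (ST⊑A v∈S (T₁⊑T z∈T₁))
        -- The product wz is regrouped as (ez)(e⁻¹w), with ez ∈ S and e⁻¹w ∈ T.
        (resp A (trans (xy*z≈y*xz e z _) (trans (*-congˡ (inverse-cancelʳ w e≉0)) (*-comm z w)))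
          (ST⊑A ez∈S w∈eT)))

  -- The stabiliser of a subspace as an intermediate field

  stabiliser : Subspace → Subspace
  stabiliser S = record
    { set = λ x → ∀ {y} → y ∈ set S → x * y ∈ set S
    ; isSubspace = record
      { resp     = λ e p y∈S → resp S (*-congʳ e) (p y∈S)
      ; 0-closed = λ _ → resp S (sym (zeroˡ _)) (0-closed S)
      ; +-closed = λ p q y∈S → resp S (sym (distribʳ _ _ _)) (+-closed S (p y∈S) (q y∈S))
      ; ·-closed = λ k∈K p y∈S → resp S (sym (*-assoc _ _ _)) (·-closed S k∈K (p y∈S))
      }
    }

  module Stabiliser {S s x₀} (dS : Dim S s) (x₀∈S : x₀ ∈ set S) (x₀≉0 : ¬ x₀ ≈ 0#) where

    M : Subspace
    M = stabiliser S

    K⊆M : K ⊆ set M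
    K⊆M k∈K = ·-closed S k∈K

    M-isIntermediateField : IsIntermediateField (set M)
    M-isIntermediateField = record
      { resp       = resp M
      ; 0-closed   = 0-closed M
      ; 1-closed   = K⊆M 𝕂.1-closed
      ; +-closed   = +-closed M
      ; neg-closed = neg∈ M
      ; *-closed   = λ p q y∈S → resp S (sym (*-assoc _ _ _)) (p (q y∈S))
      -- xS ⊆ S says S ⊆ x⁻¹S; equal finite dimensions turn this into an equality, so x⁻¹ stabilises
      -- S as well.
      ; ⁻¹-closed  = λ {x} x≉0 x∈M y∈S →
          Dim-full {S} {preimage x S} x∈M dS (Dim-preimage x≉0 dS) ℕ.≤-refl
            (resp S (sym (inverse-cancelʳ _ x≉0)) y∈S)
      } , K⊆M

    -- Multiplication by the nonzero vector x₀ embeds M into S, whence the degree of M is at most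
    -- dim S.
    M⊑ : M ⊑ preimage x₀ S
    M⊑ x∈M = resp S (*-comm _ x₀) (x∈M x₀∈S)

    Dim-M : ∃ λ m → m ≤ s × Dim M m × (m ≡ s → preimage x₀ S ⊑ M)
    Dim-M = Dim-⊑ M M⊑ (Dim-preimage x₀≉0 dS)

  -- The three conditions and the resulting dimension bound

  Hypotheses : Subspace → Subspace → ℕ → Set (lsuc (c ⊔ ℓ))
  Hypotheses A B n =
      (∀ M → IsIntermediateField M → FiniteDimensional M → M ⊂ U → set B ∩ M ≐ (_≈ 0#))
    ⊎ ( IsSmallestDegree n
      × ¬ (∃ λ M → IsIntermediateField M × K ⊂ M × M ⊂ U × IsLinearTranslate (set A) M))
    ⊎ IsSidon (set A)

  module _ {A B : Subspace} {n} (dA : Dim A n) (dB : Dim B n) (1∉B : 1# ∉ set B) where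

    module _ {S s x₀} (dS : Dim S s) (x₀∈S : x₀ ∈ set S) (x₀≉0 : ¬ x₀ ≈ 0#) (S⊑A : S ⊑ A) where

      open Stabiliser dS x₀∈S x₀≉0

      -- If M were L, every x = (x x₀⁻¹)x₀ would lie in S ⊆ A. Then A = L, and B = A by dimension,
      -- against 1 ∉ B.
      M⊂U : set M ⊂ U
      M⊂U = _ , λ U⊆M →
        let U⊆A : ∀ x → x ∈ set A
            U⊆A x = S⊑A (resp S (trans (*-assoc x _ x₀) (trans (*-congˡ
              (trans (*-comm _ x₀) (*-inv x₀ x₀≉0))) (*-identityʳ x))) (U⊆M {x * x₀ ⁻¹} _ x₀∈S))
        in 1∉B (Dim-full {B} {A} (λ _ → U⊆A _) dB dA ℕ.≤-refl (U⊆A 1#))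

      -- In x = v + w with v ∈ V and w ∈ K ⊆ M, the vector v lies in M ∩ B = 0, so x = w.
      M∩⟨1⟩⊆K : (∀ M → IsIntermediateField M → FiniteDimensional M → M ⊂ U →
          set B ∩ M ≐ (_≈ 0#)) →
        ∀ {V} → V ⊑ B → set M ∩ set (V ⟨ 1# ⟩) ⊆ K
      M∩⟨1⟩⊆K B∩M≐0 V⊑B (x∈M , v , w , v∈V , w∈K1 , x≈v+w) =
        let m , _ , dM , _ = Dim-M
            w∈K = line-1⊆K w∈K1
            v∈M = cancel∈ M (resp M x≈v+w x∈M) (K⊆M w∈K)
            v≈0 = proj₁ (B∩M≐0 (set M) M-isIntermediateField (m , Dim⇒HasDim dM) M⊂U)
                    (V⊑B v∈V , v∈M)
        in 𝕂.resp (sym (trans x≈v+w (trans (+-congʳ v≈0) (+-identityˡ w)))) w∈K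

      -- If M were larger than K, then n ≤ dim M ≤ dim S ≤ n by minimality. Hence S = A and M =
      -- x₀⁻¹S, which makes A the excluded translate x₀M.
      M⊆K-smallestDegree : IsSmallestDegree n →
        ¬ (∃ λ M → IsIntermediateField M × K ⊂ M × M ⊂ U × IsLinearTranslate (set A) M) →
        set M ⊆ K
      M⊆K-smallestDegree (_ , minimal) A≢lM {x} x∈M = decidable-stable em λ x∉K →
        let m , m≤s , dM , eq = Dim-M
            K⊂M = (λ {k} → K⊆M {k}) , λ M⊆K → x∉K (M⊆K x∈M)
            n≤m = minimal (set M) m M-isIntermediateField K⊂M (Dim⇒HasDim dM)
            s≤n = Dim-mono S⊑A dS dA
            A⊑S : A ⊑ S
            A⊑S = Dim-full S⊑A dS dA (ℕ.≤-trans n≤m m≤s)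
            A⊆x₀M : set A ⊆ x₀ • set M
            A⊆x₀M a∈A = _ , eq (ℕ.≤-antisym m≤s (ℕ.≤-trans s≤n n≤m))
              (resp S (sym (inverse-cancelʳ _ x₀≉0)) (A⊑S a∈A)) , sym (inverse-cancelʳ _ x₀≉0)
            x₀M⊆A : x₀ • set M ⊆ set A
            x₀M⊆A (z , z∈M , e) = S⊑A (resp S (trans (*-comm z x₀) (sym e)) (z∈M x₀∈S))
        in A≢lM (set M , M-isIntermediateField , K⊂M , M⊂U , x₀ , x₀≉0 , A⊆x₀M , x₀M⊆A)

      -- For x ∈ M outside K, xS ⊆ S ⊆ A puts xS into A ∩ xA. So dim S ≤ 1, hence dim M ≤ 1 and M =
      -- K, a contradiction.
      M⊆K-Sidon : IsSidon (set A) → set M ⊆ K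
      M⊆K-Sidon sidon {x} x∈M = decidable-stable em λ x∉K →
        let d , d≤1 , v , li , _ , ⊆Span = sidon x x∉K
            x≉0 = λ x≈0 → x∉K (𝕂.resp (sym x≈0) 𝕂.0-closed)
            S⊑ : S ⊑ preimage x (span v)
            S⊑ y∈S = Span⊆span v (⊆Span (S⊑A (x∈M y∈S) , _ , S⊑A y∈S , refl))
            s≤1 = ℕ.≤-trans (Dim-mono S⊑ dS (Dim-preimage x≉0 (Dim-span v li))) d≤1
            m , m≤s , dM , _ = Dim-M
        in x∉K (line-1⊆K (Dim-full (K⊆M ∘ line-1⊆K) (Dim-line 1≉0) dM (ℕ.≤-trans m≤s s≤1) x∈M))

    -- Since 1 ∉ V, the second factor has dimension d + 1. The transforms keep s + d + 1 and end
    -- with S′ ⊆ A and T′ ⊆ K, of total dimension at most n + 1.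
    product-bound : Hypotheses A B n → ∀ {S V s d} → Dim S s → Dim V d → V ⊑ B → Nonzero S →
      S · V ⟨ 1# ⟩ ⊑ A → d ℕ.+ s ≤ n
    product-bound hyp {S} {V} {s} {d} dS dV V⊑B S≉0 ST⊑A = ℕ.≤-pred (begin
      suc d ℕ.+ s   ≡⟨ ℕ.+-comm (suc d) s ⟩
      s ℕ.+ suc d   ≡⟨ s′+t′ ⟨
      s′ ℕ.+ t′     ≤⟨ ℕ.+-mono-≤ (Dim-mono S′⊑A Dim-S′ dA)
                         (Dim-mono (K⊆line-1 ∘ T′⊆K hyp) Dim-T′ (Dim-line 1≉0)) ⟩
      n ℕ.+ 1       ≡⟨ ℕ.+-comm n 1 ⟩
      suc n         ∎)
      where
      open ℕ.≤-Reasoning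
      open StablePair (e-transform {A} (<-wellFounded (suc d)) dS
        (extend (⋖-intro V (1∉B ∘ V⊑B)) dV) (⟨⟩-in V 1#) S≉0 ST⊑A)
      T′⊆M : T′ ⊑ stabiliser S′
      T′⊆M x∈T′ y∈S′ = resp S′ (*-comm _ _) (stable y∈S′ x∈T′)
      x₀∈S′ = proj₁ (proj₂ nonzero)
      x₀≉0  = proj₂ (proj₂ nonzero)
      T′⊆K : Hypotheses A B n → set T′ ⊆ K
      T′⊆K (inj₁ h) x∈T′ =
        M∩⟨1⟩⊆K Dim-S′ x₀∈S′ x₀≉0 S′⊑A h {V} V⊑B (T′⊆M x∈T′ , T′⊑T x∈T′)
      T′⊆K (inj₂ (inj₁ (h , h′))) x∈T′ =
        M⊆K-smallestDegree Dim-S′ x₀∈S′ x₀≉0 S′⊑A h h′ (T′⊆M x∈T′)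
      T′⊆K (inj₂ (inj₂ h)) x∈T′ = M⊆K-Sidon Dim-S′ x₀∈S′ x₀≉0 S′⊑A h (T′⊆M x∈T′)

    -- The spaces aⱼ⁻¹A ∩ B, their Rado condition and the matching

    obstruction : Vector Carrier n → Family n
    obstruction a j = preimage (a j) A ⊓ B

    -- The span S of the aⱼ with j ∈ J has dimension ∣ J ∣, and S multiplies both the meet V and 1
    -- into A, so `product-bound` applies.
    obstruction-rado : Hypotheses A B n → ∀ {a} → IsBasis a (set A) → RadoCondition B (obstruction a)
    obstruction-rado hyp {a} (li , Span⊆A , _) J {d} dV = go (Dim-subspan J a li)
      where
      V = meet B (obstruction a) J
      a∈A : ∀ j → a j ∈ set A
      a∈A j = Span⊆A (span⊆Span a (∈-span a j))
      ST⊑A : subspan J a · V ⟨ 1# ⟩ ⊑ A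
      ST⊑A {x} x∈S = ⟨⟩-least V (preimage x A)
        (λ {v} v∈V → resp A (*-comm v x) (subspan-least J (preimage v A)
          (λ j j∈J → resp A (*-comm (a j) v) (proj₁ (proj₂ v∈V j j∈J))) x∈S))
        (resp A (sym (*-identityʳ x)) (subspan-least J A (λ j _ → a∈A j) x∈S))
      go : ∀ {s} → Dim (subspan J a) s → d ℕ.+ s ≤ n
      -- Here S = 0 offers no nonzero vector for the transforms, and the bound reduces to dim V ≤
      -- dim B.
      go {zero}  dS = ≡.subst (_≤ n) (≡.sym (ℕ.+-identityʳ d)) (Dim-mono proj₁ dV dB)
      go {suc s} dS = product-bound hyp dS dV proj₁ (nonzero-member dS) ST⊑A

  matched : ∀ A B {n} → HasDim (set A) (suc n) → HasDim (set B) (suc n) → 1# ∉ set B →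
    Hypotheses A B (suc n) → Matched (suc n) (set A) (set B)
  matched A B {n} (_ , basisA) (_ , basisB) 1∉B hyp a basis =
    let dA = Dim-basis A basisA
        dB = Dim-basis B basisB
        b , basis-b , F⊆ = linear-rado {F = obstruction {A} {B} dA dB 1∉B a} dB (λ _ → proj₂)
          (obstruction-rado dA dB 1∉B hyp basis)
    -- From y = aᵢ⁻¹x follows aᵢy = x ∈ A, as a basis vector is nonzero; this puts y into the i-th
    -- obstruction.
    in b , basis-b , λ i ((x , x∈A , y≈) , y∈B) → F⊆ i
      (resp A (sym (trans (*-congˡ y≈) (inverse-cancelʳ x (LI⇒≉0 a (proj₁ basis) i)))) x∈A , y∈B)

theorem1p8 : (∀ {a} → ExcludedMiddle a) →
    ∀ {c ℓ} (L : Field c ℓ) →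
    let open Field L
        open FieldTheory L in
    (K : Subset) → IsSubfield K →
    let open Over K in
    (n : ℕ) → 1 < n →
    (A B : Subset) →
    IsSubspace A → HasDim A n →
    IsSubspace B → HasDim B n →
    1# ∉ B →
    ( ( (∀ M → IsIntermediateField M → FiniteDimensional M → M ⊂ U →
           B ∩ M ≐ (_≈ 0#))
      × (n ≤ 5 ⊎ (∀ x → IsAlgebraic x → IsSeparable x)))
    ⊎ ( IsSmallestDegree n
      × ¬ (∃ λ M → IsIntermediateField M × K ⊂ M × M ⊂ U × IsLinearTranslate A M))
    ⊎ IsSidon A ) →
    Matched n A B
theorem1p8 em L K K-isSubfield (suc n) _ A B A-isSubspace dimA B-isSubspace dimB 1∉B hyp =
  matched (record { set = A ; isSubspace = A-isSubspace })
          (record { set = B ; isSubspace = B-isSubspace })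
          dimA dimB 1∉B (map₁ proj₁ hyp)
  where open LinearMatching em L K K-isSubfield
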